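{- Let $n \geq 2$ and $d \geq 1$ be integers and let $M$ be a $k \times n$ matrix with entries in $\mathbb{Z}_{d+1}$. For nonnegative integers $e_1,\dots,e_d$ with $0 \leq e_1 + \dots + e_d \leq k$, let $y_{e_1,\dots,e_d}$ denote the number of columns of $M$ that contain exactly $e_s$ occurrences of $s$ for each $s \in \{1,\dots,d\}$. For each $i = 1,\dots,k$, player $i$ sees all of $M$ except row $i$. If $k \geq 4^d \log n$, then there exists a deterministic simultaneous Number-On-the-Forehead protocol of cost at most $k \binom{k+d}{d} \lceil \log n \rceil$ at the end of which the referee knows all the numbers $y_{e_1,\dots,e_d}$.
   Context: Logarithms are base 2. $\mathbb{Z}_{d+1} = \{0,\dots,d\}$. Deterministic simultaneous Number-On-the-Forehead model: each of the $k$ players, without communicating with the other players, sends a message depending deterministically on what she sees (here, all rows of $M$ except her own row) to a referee who sees nothing of $M$; the referee must then determine the required output from the messages alone. The cost is the worst-case total number of bits sent to the referee. -}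

module Defs where

open import Data.Nat using (ℕ; suc; _+_; _*_; _^_; _≤_)
open import Data.Nat.Properties using (_≟_)
open import Data.Fin using (Fin; suc)
open import Data.Fin.Properties using (all?) renaming (_≟_ to _≟ᶠ_)
open import Data.List using (List; length; filter; map; allFin)
open import Data.Nat.ListAction using (sum)
open import Data.Bool using (Bool)
open import Data.Product using (Σ; _×_)
open import Relation.Binary.PropositionalEquality using (_≡_; _≢_)

Matrix : ℕ → ℕ → ℕ → Set
Matrix k n d = Fin k → Fin n → Fin (suc d)

occ : ∀ {k n d} → Matrix k n d → Fin n → Fin (suc d) → ℕ
occ {k} M c s = length (filter (λ i → M i c ≟ᶠ s) (allFin k))

-- y_{e_1..e_d}: number of columns containing exactly e_s occurrences of s
-- for every s ∈ {1,…,d}  (e is indexed by Fin d, e s ↔ e_{s+1})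
yCount : ∀ {k n d} → Matrix k n d → (Fin d → ℕ) → ℕ
yCount {k} {n} {d} M e =
  length (filter (λ c → all? (λ s → occ M c (suc s) ≟ e s)) (allFin n))

sumE : ∀ {d} → (Fin d → ℕ) → ℕ
sumE {d} e = sum (map e (allFin d))

AgreeOff : ∀ {k n d} → Fin k → Matrix k n d → Matrix k n d → Set
AgreeOff {k} i M M' = ∀ (j : Fin k) → j ≢ i → M j ≡ M' j

-- A deterministic simultaneous NOF protocol computing all y's, with cost
-- at most `cost`: player i sends a bit string msg i M depending only on
-- what she sees; the referee maps the k messages to the answer, which is
-- the function e ↦ y_e (required correct whenever e_1+…+e_d ≤ k);
-- worst-case total number of bits sent is ≤ cost.
record YProtocol (k n d cost : ℕ) : Set where
  field
    msg      : Fin k → Matrix k n d → List Bool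
    msg-view : ∀ (i : Fin k) (M M' : Matrix k n d) →
               AgreeOff i M M' → msg i M ≡ msg i M'
    referee  : (Fin k → List Bool) → (Fin d → ℕ) → ℕ
    correct  : ∀ (M : Matrix k n d) (e : Fin d → ℕ) → sumE e ≤ k →
               referee (λ i → msg i M) e ≡ yCount M e
    cost-ok  : ∀ (M : Matrix k n d) →
               sum (map (λ i → length (msg i M)) (allFin k)) ≤ cost

{-# OPTIONS --safe #-}
-- The profile of a column is the vector f ∈ ℕ^d of its symbol counts. Each
-- player sends, for every profile, the number of columns having it outside
-- her row. It suffices to show that these messages determine the multiset of
-- profiles: the referee can then search for a matrix with the same messages.
--
-- Suppose M and M′ give the same messages and let E φ be the sum of φ over
-- the profiles of M minus that over the profiles of M′. For the products of
-- binomial coefficients mono β f = ∏ₛ (f s) C (β s), summing over the deleted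
-- row gives Σᵢ mono β (f without row i) = (k - |β|) mono β f, so E (mono β)
-- vanishes unless |β| = k. Such an integer-valued E of mass L is zero or has
-- 5 ^ k ≤ L ^ (4 ^ d), by induction on d. Let J be the top of the support of E
-- in the first coordinate, and E (mono (J ∷ α)) ≠ 0, so J + |α| = k. If
-- 4 |α| > k, apply induction to the slice at J. Otherwise integrate
-- (-2)^j mono α f = Σᵢ (-3)^i mono (i ∷ α) (j ∷ f): only i = J contributes,
-- whence 3 ^ J ≤ L 2 ^ k. Finally L = 2n is too small, because
-- (2n) ^ (4 ^ d) ≤ (n ^ (4 ^ d)) ^ 2 ≤ 4 ^ k < 5 ^ k.
module Submission where

open import Defs
open import Data.Nat using (ℕ; zero; suc; _+_; _*_; _∸_; _^_; _≤_; _<_; z≤n; s≤s; NonZero; >-nonZero; _≤?_; _<?_; ⌈_/2⌉; ⌊_/2⌋)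
open import Data.Nat.Properties
open import Data.Nat.Induction using (<-rec)
open import Data.Nat.Combinatorics using (_C_; nCn≡1; k>n⇒nCk≡0; nCk+nC[k+1]≡[n+1]C[k+1])
open import Data.Nat.Logarithm using (⌈log₂_⌉; ⌈log₂⌉-mono-≤; ⌈log₂⌈n/2⌉⌉≡⌈log₂n⌉∸1)
import Data.Nat.ListAction as ListAction
open import Data.Integer as ℤ using (ℤ; +_; -[1+_]; ∣_∣; 0ℤ; 1ℤ)
import Data.Integer.Properties as ℤ
import Data.Integer.Tactic.RingSolver as ℤ
import Data.Nat.Tactic.RingSolver as ℕ
open import Data.Fin using (Fin; zero; suc; finToFun; funToFin)
open import Data.Fin.Properties using (all?; any?; finToFun-funToFin) renaming (_≟_ to _≟ᶠ_; suc-injective to sucᶠ-injective)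
open import Data.Vec using (Vec; []; _∷_; sum; replicate; updateAt; lookup)
open import Data.Vec.Properties using (≡-dec; lookup∘updateAt; lookup∘updateAt′; lookup-replicate)
open import Data.List using (List; []; _∷_; _++_; length; filter; map; concatMap; allFin; tabulate)
open import Data.List.Properties using (length-map; length-++; length-tabulate; map-tabulate; map-cong; filter-notAll; ∷-injectiveˡ; ∷-injectiveʳ)
import Data.List.Properties as List
open import Data.List.Membership.Propositional using (_∈_)
open import Data.List.Membership.Propositional.Properties using (∈-map⁺; ∈-map⁻; ∈-++⁺ˡ; ∈-++⁺ʳ)
open import Data.List.Relation.Unary.Any using (Any; here; there)
open import Data.List.Relation.Unary.All as All using (All; []; _∷_)
open import Data.List.Relation.Unary.All.Properties using (¬All⇒Any¬; map⁺)
open import Data.List.Relation.Unary.AllPairs using ([]; _∷_)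
open import Data.List.Relation.Unary.Unique.Propositional using (Unique)
import Data.List.Relation.Unary.Unique.Propositional.Properties as Unique
open import Data.Product using (∃; _×_; _,_; proj₁; proj₂)
open import Data.Sum using (_⊎_; inj₁; inj₂)
open import Data.Bool using (Bool; true; false; if_then_else_)
import Data.Bool.Properties as Bool
open import Function using (_∘_; id; mk⇔; _⇔_)
open import Relation.Nullary.Decidable using (decidable-stable; does-⇔; dec-true; dec-false)
open import Relation.Nullary using (¬_; Dec; yes; no; contradiction; does)
open import Relation.Unary using (Decidable)
open import Relation.Binary.Definitions using (DecidableEquality)
open import Relation.Binary.PropositionalEquality using (_≡_; _≢_; _≗_; refl; sym; trans; cong; cong₂; subst; module ≡-Reasoning)

private variable
  d k n L : ℕ
  A B : Set

-- Binomial coefficients of vectors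

binom : Vec ℕ d → Vec ℕ d → ℕ
binom []      []      = 1
binom (j ∷ f) (i ∷ β) = (j C i) * binom f β

mono : Vec ℕ d → Vec ℕ d → ℤ
mono β f = + binom f β

nCi≤2^n : ∀ n i → n C i ≤ 2 ^ n
nCi≤2^n n       zero    = m^n>0 2 n
nCi≤2^n zero    (suc i) = z≤n
nCi≤2^n (suc n) (suc i) = begin
  suc n C suc i          ≡⟨ nCk+nC[k+1]≡[n+1]C[k+1] n i ⟨
  n C i + n C suc i      ≤⟨ +-mono-≤ (nCi≤2^n n i) (nCi≤2^n n (suc i)) ⟩
  2 ^ n + 2 ^ n          ≡⟨ cong (λ m → 2 ^ n + m) (+-identityʳ (2 ^ n)) ⟨
  2 ^ suc n              ∎
  where open ≤-Reasoning

binom≤2^sum : (f β : Vec ℕ d) → binom f β ≤ 2 ^ sum f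
binom≤2^sum []      []      = ≤-refl
binom≤2^sum (j ∷ f) (i ∷ β) =
  ≤-trans (*-mono-≤ (nCi≤2^n j i) (binom≤2^sum f β)) (≤-reflexive (sym (^-distribˡ-+-* 2 j (sum f))))

-- The first `K` terms of the Newton series Σᵢ a^i (j C i) of (1 + a)^j.
newton : ℤ → ℕ → ℕ → ℤ
newton a zero    j = 0ℤ
newton a (suc K) j = newton a K j ℤ.+ a ℤ.^ K ℤ.* + (j C K)

-- Pascal's rule in every term: the part with j C (i - 1) is the series one term shorter, with a
-- factor `a` taken out.
newton-suc : ∀ a K j → newton a (suc K) (suc j) ≡ a ℤ.* newton a K j ℤ.+ newton a (suc K) j
newton-suc a zero    j = ring a
  where
  ring : ∀ a → 0ℤ ℤ.+ 1ℤ ℤ.* 1ℤ ≡ a ℤ.* 0ℤ ℤ.+ (0ℤ ℤ.+ 1ℤ ℤ.* 1ℤ)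
  ring = ℤ.solve-∀
newton-suc a (suc K) j = begin
  newton a (suc K) (suc j) ℤ.+ a ℤ.^ suc K ℤ.* + (suc j C suc K)
    ≡⟨ cong₂ (λ p q → p ℤ.+ a ℤ.^ suc K ℤ.* q) (newton-suc a K j) pascal ⟩
  (a ℤ.* newton a K j ℤ.+ newton a (suc K) j) ℤ.+ (a ℤ.* a ℤ.^ K) ℤ.* (+ (j C K) ℤ.+ + (j C suc K))
    ≡⟨ ring a (newton a K j) (newton a (suc K) j) (a ℤ.^ K) (+ (j C K)) (+ (j C suc K)) ⟩
  a ℤ.* newton a (suc K) j ℤ.+ newton a (suc (suc K)) j ∎
  where
  open ≡-Reasoning
  pascal : + (suc j C suc K) ≡ + (j C K) ℤ.+ + (j C suc K)
  pascal = trans (cong +_ (sym (nCk+nC[k+1]≡[n+1]C[k+1] j K))) (ℤ.pos-+ (j C K) (j C suc K))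
  ring : ∀ a p q w x y → (a ℤ.* p ℤ.+ q) ℤ.+ (a ℤ.* w) ℤ.* (x ℤ.+ y) ≡
         a ℤ.* (p ℤ.+ w ℤ.* x) ℤ.+ (q ℤ.+ (a ℤ.* w) ℤ.* y)
  ring = ℤ.solve-∀

newton-zero : ∀ a K → newton a (suc K) 0 ≡ 1ℤ
newton-zero a zero    = refl
newton-zero a (suc K) = trans (cong₂ ℤ._+_ (newton-zero a K) (ℤ.*-zeroʳ (a ℤ.^ suc K))) refl

-- The omitted terms have i ≥ K > j, hence j C i = 0, and the binomial theorem survives the
-- truncation.
newton≡ : ∀ a {K j} → j < K → newton a K j ≡ (1ℤ ℤ.+ a) ℤ.^ j
newton≡ a {suc K} {zero}  _         = newton-zero a K
newton≡ a {suc K} {suc j} (s≤s j<K) = begin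
  newton a (suc K) (suc j)                       ≡⟨ newton-suc a K j ⟩
  a ℤ.* newton a K j ℤ.+ newton a (suc K) j
    ≡⟨ cong₂ (λ p q → a ℤ.* p ℤ.+ q) (newton≡ a j<K) (newton≡ a (m<n⇒m<1+n j<K)) ⟩
  a ℤ.* (1ℤ ℤ.+ a) ℤ.^ j ℤ.+ (1ℤ ℤ.+ a) ℤ.^ j    ≡⟨ ring a ((1ℤ ℤ.+ a) ℤ.^ j) ⟩
  (1ℤ ℤ.+ a) ℤ.* (1ℤ ℤ.+ a) ℤ.^ j                ∎
  where
  open ≡-Reasoning
  ring : ∀ a w → a ℤ.* w ℤ.+ w ≡ (1ℤ ℤ.+ a) ℤ.* w
  ring = ℤ.solve-∀

∣i^n∣ : ∀ i n → ∣ i ℤ.^ n ∣ ≡ ∣ i ∣ ^ n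
∣i^n∣ i zero    = refl
∣i^n∣ i (suc n) = trans (ℤ.abs-* i (i ℤ.^ n)) (cong (∣ i ∣ *_) (∣i^n∣ i n))

-- Signed measures and their factorial moments

-- A signed measure of total mass at most L on the points f of ℕ^d with
-- sum f ≤ k, given by its integral.
record Measure (k L : ℕ) (E : (Vec ℕ d → ℤ) → ℤ) : Set where
  field
    additive    : ∀ φ ψ → E (λ f → φ f ℤ.+ ψ f) ≡ E φ ℤ.+ E ψ
    homogeneous : ∀ a φ → E (λ f → a ℤ.* φ f) ≡ a ℤ.* E φ
    local       : ∀ φ ψ → (∀ f → sum f ≤ k → φ f ≡ ψ f) → E φ ≡ E ψ
    bounded     : ∀ B φ → (∀ f → sum f ≤ k → ∣ φ f ∣ ≤ B) → ∣ E φ ∣ ≤ L * B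

IsZero : ((Vec ℕ d → ℤ) → ℤ) → Set
IsZero E = ∀ φ → E φ ≡ 0ℤ

infixr 7 _⊗_
_⊗_ : (ℕ → ℤ) → (Vec ℕ d → ℤ) → Vec ℕ (suc d) → ℤ
(g ⊗ ψ) (j ∷ f) = g j ℤ.* ψ f

δ : ℕ → ℕ → ℤ
δ zero    zero    = 1ℤ
δ zero    (suc j) = 0ℤ
δ (suc i) zero    = 0ℤ
δ (suc i) (suc j) = δ i j

δ-refl : ∀ i → δ i i ≡ 1ℤ
δ-refl zero    = refl
δ-refl (suc i) = δ-refl i

δ-≢ : ∀ {i j} → i ≢ j → δ i j ≡ 0ℤ
δ-≢ {zero}  {zero}  0≢0 = contradiction refl 0≢0
δ-≢ {zero}  {suc j} _   = refl
δ-≢ {suc i} {zero}  _   = refl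
δ-≢ {suc i} {suc j} i≢j = δ-≢ (i≢j ∘ cong suc)

slice : ℕ → ((Vec ℕ (suc d) → ℤ) → ℤ) → (Vec ℕ d → ℤ) → ℤ
slice J E ψ = E (δ J ⊗ ψ)

-- A point `J ∷ f` of the support leaves k - J = m for `f`, and a factor `δ J` never enlarges an
-- integrand, so the mass bound `L` is kept.
slice-measure : ∀ {E : (Vec ℕ (suc d) → ℤ) → ℤ} {J m} → J + m ≡ k →
                Measure k L E → Measure m L (slice J E)
slice-measure {k = k} {E = E} {J} {m} J+m≡k μ = record
  { additive    = λ φ ψ → trans
      (local _ _ λ { (j ∷ f) _ → ℤ.*-distribˡ-+ (δ J j) (φ f) (ψ f) })
      (additive (δ J ⊗ φ) (δ J ⊗ ψ))
  ; homogeneous = λ a φ → trans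
      (local _ _ λ { (j ∷ f) _ → ring (δ J j) a (φ f) })
      (homogeneous a (δ J ⊗ φ))
  ; local       = λ φ ψ eq → local _ _ (local′ φ ψ eq)
  ; bounded     = λ B φ ≤B → bounded B _ (bounded′ B φ ≤B)
  }
  where
  open Measure μ
  ring : ∀ x a y → x ℤ.* (a ℤ.* y) ≡ a ℤ.* (x ℤ.* y)
  ring = ℤ.solve-∀
  fits : ∀ (f : Vec ℕ _) → J + sum f ≤ k → sum f ≤ m
  fits _ ≤k = +-cancelˡ-≤ J _ _ (≤-trans ≤k (≤-reflexive (sym J+m≡k)))
  local′ : ∀ φ ψ → (∀ f → sum f ≤ m → φ f ≡ ψ f) → ∀ f → sum f ≤ k → (δ J ⊗ φ) f ≡ (δ J ⊗ ψ) f
  local′ φ ψ eq (j ∷ f) ≤k with J ≟ j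
  ... | yes refl = cong (δ J J ℤ.*_) (eq f (fits f ≤k))
  ... | no J≢j rewrite δ-≢ J≢j = refl
  bounded′ : ∀ B φ → (∀ f → sum f ≤ m → ∣ φ f ∣ ≤ B) → ∀ f → sum f ≤ k → ∣ (δ J ⊗ φ) f ∣ ≤ B
  bounded′ B φ ≤B (j ∷ f) ≤k with J ≟ j
  ... | yes refl rewrite δ-refl J | ℤ.*-identityˡ (φ f) = ≤B f (fits f ≤k)
  ... | no J≢j rewrite δ-≢ J≢j = z≤n

-- A measure is known only through its integral, so a bound on the heads of its support becomes
-- blindness to values at larger heads.
HeadBound : ℕ → ((Vec ℕ (suc d) → ℤ) → ℤ) → Set
HeadBound K E = ∀ φ ψ → (∀ j f → j ≤ K → φ (j ∷ f) ≡ ψ (j ∷ f)) → E φ ≡ E ψ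

-- For heads j ≤ J the point mass δ J j equals the binomial coefficient j C J.
slice-mono : ∀ {E : (Vec ℕ (suc d) → ℤ) → ℤ} {J} → HeadBound J E →
             ∀ α → slice J E (mono α) ≡ E (mono (J ∷ α))
slice-mono {J = J} bound α = bound _ _ λ j f j≤J →
  trans (cong (ℤ._* + binom f α) (δ≡C j j≤J)) (sym (ℤ.pos-* (j C J) (binom f α)))
  where
  δ≡C : ∀ j → j ≤ J → δ J j ≡ + (j C J)
  δ≡C j j≤J with J ≟ j
  ... | yes refl = trans (δ-refl J) (cong +_ (sym (nCn≡1 J)))
  ... | no J≢j   = trans (δ-≢ J≢j) (cong +_ (sym (k>n⇒nCk≡0 (≤∧≢⇒< j≤J (J≢j ∘ sym)))))

-- `J` is the largest head of the support. That its slice is nonzero is witnessed by a moment, which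
-- `slice-mono` turns into a moment of `E`.
record Top (E : (Vec ℕ (suc d) → ℤ) → ℤ) : Set where
  constructor top
  field
    J       : ℕ
    α       : Vec ℕ d
    J-bound : HeadBound J E
    nonzero : slice J E (mono α) ≢ 0ℤ

-- Up to head K + 1, `φ` is `ψ` plus a function concentrated on head K + 1, where everything
-- integrates to zero.
headBound-pred : ∀ {E : (Vec ℕ (suc d) → ℤ) → ℤ} {K} → Measure k L E →
                 HeadBound (suc K) E → IsZero (slice (suc K) E) → HeadBound K E
headBound-pred {E = E} {K} μ bound zero-slice φ ψ eq = begin
  E φ                                        ≡⟨ bound _ _ φ≡ ⟩
  E (λ f → ψ f ℤ.+ (δ (suc K) ⊗ χ) f)        ≡⟨ additive ψ (δ (suc K) ⊗ χ) ⟩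
  E ψ ℤ.+ slice (suc K) E χ                  ≡⟨ cong (ℤ._+_ (E ψ)) (zero-slice χ) ⟩
  E ψ ℤ.+ 0ℤ                                 ≡⟨ ℤ.+-identityʳ (E ψ) ⟩
  E ψ                                        ∎
  where
  open ≡-Reasoning
  open Measure μ
  χ : Vec ℕ _ → ℤ
  χ f = φ (suc K ∷ f) ℤ.- ψ (suc K ∷ f)
  ring : ∀ x y → x ≡ y ℤ.+ 1ℤ ℤ.* (x ℤ.- y)
  ring = ℤ.solve-∀
  φ≡ : ∀ j f → j ≤ suc K → φ (j ∷ f) ≡ ψ (j ∷ f) ℤ.+ δ (suc K) j ℤ.* χ f
  φ≡ j f j≤ with suc K ≟ j
  ... | yes refl rewrite δ-refl K = ring (φ (j ∷ f)) (ψ (j ∷ f))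
  ... | no K≢j rewrite δ-≢ K≢j = trans (eq j f (≤-pred (≤∧≢⇒< j≤ (K≢j ∘ sym)))) (sym (ℤ.+-identityʳ _))

-- Factorial moments separate measures: by induction on `d` the top slice of a nonzero measure has a
-- nonzero moment, and `slice-mono` lifts it to `E`.
zero-or-moment : ∀ {E : (Vec ℕ d → ℤ) → ℤ} → Measure k L E → IsZero E ⊎ ∃ λ β → E (mono β) ≢ 0ℤ
-- Search downwards from head `k`, above which no point satisfies `sum f ≤ k`; each vanishing slice
-- lowers the head bound by one.
zero-or-top    : ∀ {E : (Vec ℕ (suc d) → ℤ) → ℤ} → Measure k L E → IsZero E ⊎ Top E

zero-or-moment {zero} {E = E} μ with E (mono []) ℤ.≟ 0ℤ
... | yes ≡0 = inj₁ λ φ → begin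
  E φ                          ≡⟨ local _ _ (λ { [] _ → sym (ℤ.*-identityʳ (φ [])) }) ⟩
  E (λ f → φ [] ℤ.* mono [] f) ≡⟨ homogeneous (φ []) (mono []) ⟩
  φ [] ℤ.* E (mono [])         ≡⟨ cong (φ [] ℤ.*_) ≡0 ⟩
  φ [] ℤ.* 0ℤ                  ≡⟨ ℤ.*-zeroʳ (φ []) ⟩
  0ℤ                           ∎
  where
  open ≡-Reasoning
  open Measure μ
... | no ≢0  = inj₂ ([] , ≢0)
zero-or-moment {suc d} μ with zero-or-top μ
... | inj₁ E≡0                      = inj₁ E≡0
... | inj₂ (top J α bound ≢0) = inj₂ (J ∷ α , λ ≡0 → ≢0 (trans (slice-mono bound α) ≡0))

zero-or-top {k = k} {E = E} μ = search k 0 (+-identityʳ k)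
  (λ φ ψ eq → local _ _ λ { (j ∷ f) ≤k → eq j f (m+n≤o⇒m≤o j ≤k) })
  where
  open Measure μ
  search : ∀ K m → K + m ≡ k → HeadBound K E → IsZero E ⊎ Top E
  search K m K+m≡k bound with zero-or-moment {E = slice K E} (slice-measure {J = K} K+m≡k μ)
  ... | inj₂ (α , ≢0) = inj₂ (top K α bound ≢0)
  -- With head bound 0, the slice at 0 is all of `E`.
  search zero m K+m≡k bound | inj₁ slice≡0 = inj₁ λ φ →
    trans (bound φ (δ 0 ⊗ (φ ∘ (0 ∷_))) λ { zero f _ → sym (ℤ.*-identityˡ (φ (0 ∷ f))) })
          (slice≡0 (φ ∘ (0 ∷_)))
  search (suc K) m K+m≡k bound | inj₁ slice≡0 =
    search K (suc m) (trans (+-suc K m) K+m≡k) (headBound-pred μ bound slice≡0)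

-- Integrate (-2)^j binom f α over the points j ∷ f: it is bounded by 2^k,
-- and since (-2)^j = Σᵢ (-3)^i (j C i) only the moment J ∷ α contributes.
moment-bound : ∀ {E : (Vec ℕ (suc d) → ℤ) → ℤ} → Measure k L E →
               (∀ β → sum β ≢ k → E (mono β) ≡ 0ℤ) →
               ∀ {J} α → HeadBound J E → J + sum α ≡ k → E (mono (J ∷ α)) ≢ 0ℤ →
               3 ^ J ≤ L * 2 ^ k
moment-bound {k = k} {L} {E} μ vanish {J} α bound J+α≡k ≢0 = begin
  3 ^ J                                ≡⟨ *-identityʳ (3 ^ J) ⟨
  3 ^ J * 1                            ≤⟨ *-monoʳ-≤ (3 ^ J) (n≢0⇒n>0 (≢0 ∘ ℤ.∣i∣≡0⇒i≡0)) ⟩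
  3 ^ J * ∣ E (mono (J ∷ α)) ∣         ≡⟨ cong (_* ∣ E (mono (J ∷ α)) ∣) (∣i^n∣ a J) ⟨
  ∣ a ℤ.^ J ∣ * ∣ E (mono (J ∷ α)) ∣   ≡⟨ ℤ.abs-* (a ℤ.^ J) _ ⟨
  ∣ a ℤ.^ J ℤ.* E (mono (J ∷ α)) ∣     ≡⟨ cong ∣_∣ integral ⟨
  ∣ E (((1ℤ ℤ.+ a) ℤ.^_) ⊗ mono α) ∣   ≤⟨ bounded (2 ^ k) _ small ⟩
  L * 2 ^ k                            ∎
  where
  open ≤-Reasoning
  open Measure μ
  a : ℤ
  -- This is -3: then 1 + a = -2, and the growth 2^j fits the estimate of `binom f α` by 2^(sum f),
  -- while `a` itself has absolute value 3.
  a = -[1+ 2 ]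
  small : ∀ f → sum f ≤ k → ∣ (((1ℤ ℤ.+ a) ℤ.^_) ⊗ mono α) f ∣ ≤ 2 ^ k
  small (j ∷ f) ≤k = begin
    ∣ (1ℤ ℤ.+ a) ℤ.^ j ℤ.* mono α f ∣   ≡⟨ ℤ.abs-* ((1ℤ ℤ.+ a) ℤ.^ j) (mono α f) ⟩
    ∣ (1ℤ ℤ.+ a) ℤ.^ j ∣ * binom f α    ≡⟨ cong (_* binom f α) (∣i^n∣ (1ℤ ℤ.+ a) j) ⟩
    2 ^ j * binom f α                   ≤⟨ *-monoʳ-≤ (2 ^ j) (binom≤2^sum f α) ⟩
    2 ^ j * 2 ^ sum f                   ≡⟨ ^-distribˡ-+-* 2 j (sum f) ⟨
    2 ^ (j + sum f)                     ≤⟨ ^-monoʳ-≤ 2 ≤k ⟩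
    2 ^ k                               ∎
  ring : ∀ p w x y → (p ℤ.+ w ℤ.* x) ℤ.* y ≡ p ℤ.* y ℤ.+ w ℤ.* (x ℤ.* y)
  ring = ℤ.solve-∀
  step : ∀ K → E (newton a (suc K) ⊗ mono α) ≡ E (newton a K ⊗ mono α) ℤ.+ a ℤ.^ K ℤ.* E (mono (K ∷ α))
  step K = trans
    (local _ _ λ { (j ∷ f) _ → trans (ring (newton a K j) (a ℤ.^ K) (+ (j C K)) (mono α f))
                                     (cong (λ z → newton a K j ℤ.* mono α f ℤ.+ a ℤ.^ K ℤ.* z)
                                           (sym (ℤ.pos-* (j C K) (binom f α)))) })
    (trans (additive (newton a K ⊗ mono α) (λ f → a ℤ.^ K ℤ.* mono (K ∷ α) f))
           (cong (ℤ._+_ (E (newton a K ⊗ mono α))) (homogeneous (a ℤ.^ K) (mono (K ∷ α)))))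
  -- For K < J the moment `K ∷ α` has degree less than `k` and vanishes.
  low : ∀ K → K ≤ J → E (newton a K ⊗ mono α) ≡ 0ℤ
  low zero    _   = trans (local _ _ λ { (j ∷ f) _ → refl {x = 0ℤ} }) (homogeneous 0ℤ (λ _ → 0ℤ))
  low (suc K) K<J = trans (step K) (cong₂ ℤ._+_ (low K (<⇒≤ K<J))
    (trans (cong (a ℤ.^ K ℤ.*_) (vanish (K ∷ α) λ eq → <⇒≢ K<J (+-cancelʳ-≡ (sum α) K J (trans eq (sym J+α≡k)))))
           (ℤ.*-zeroʳ (a ℤ.^ K))))
  integral : E (((1ℤ ℤ.+ a) ℤ.^_) ⊗ mono α) ≡ a ℤ.^ J ℤ.* E (mono (J ∷ α))
  integral = trans
    -- On the heads that `E` sees, J + 1 terms of the series already give the full power.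
    (bound _ _ λ j f j≤J → cong (ℤ._* mono α f) (sym (newton≡ a (s≤s j≤J))))
    (trans (step J) (trans (cong (ℤ._+ a ℤ.^ J ℤ.* E (mono (J ∷ α))) (low J ≤-refl)) (ℤ.+-identityˡ _)))

-- Power inequalities and the lower bound on the mass

m^4^[1+d] : ∀ m d → m ^ (4 ^ suc d) ≡ (m ^ (4 ^ d)) ^ 4
m^4^[1+d] m d = trans (cong (m ^_) (*-comm 4 (4 ^ d))) (sym (^-*-assoc m (4 ^ d) 4))

^-distribʳ-* : ∀ k m n → (m * n) ^ k ≡ m ^ k * n ^ k
^-distribʳ-* zero    m n = refl
^-distribʳ-* (suc k) m n = trans (cong (m * n *_) (^-distribʳ-* k m n))
  ([m*n]*[o*p]≡[m*o]*[n*p] m n (m ^ k) (n ^ k))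

-- Division by m^k reduces a bound on k-th powers to one numerical inequality, with a = 5, `b` a
-- power of 3 and `m` a power of 2 in the applications.
^-cancelʳ-* : ∀ a b m k L → .{{NonZero m}} → a * m ≤ b → b ^ k ≤ L * m ^ k → a ^ k ≤ L
^-cancelʳ-* a b m k L am≤b b^k≤ = *-cancelʳ-≤ (a ^ k) L (m ^ k) {{m^n≢0 m k}} (begin
  a ^ k * m ^ k  ≡⟨ ^-distribʳ-* k a m ⟨
  (a * m) ^ k    ≤⟨ ^-monoˡ-≤ k am≤b ⟩
  b ^ k          ≤⟨ b^k≤ ⟩
  L * m ^ k      ∎)
  where open ≤-Reasoning

raise : ∀ {J k L} e → 3 ^ J ≤ L * 2 ^ k → 3 ^ (J * e) ≤ L ^ e * (2 ^ e) ^ k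
raise {J} {k} {L} e h = begin
  3 ^ (J * e)          ≡⟨ ^-*-assoc 3 J e ⟨
  (3 ^ J) ^ e          ≤⟨ ^-monoˡ-≤ e h ⟩
  (L * 2 ^ k) ^ e      ≡⟨ ^-distribʳ-* e L (2 ^ k) ⟩
  L ^ e * (2 ^ k) ^ e  ≡⟨ cong (L ^ e *_)
                            (trans (^-*-assoc 2 k e) (trans (cong (2 ^_) (*-comm k e)) (sym (^-*-assoc 2 e k)))) ⟩
  L ^ e * (2 ^ e) ^ k  ∎
  where open ≤-Reasoning

-- 81 / 2^4 > 5.
5^k≤L^4 : ∀ {k L} → 3 ^ k ≤ L * 2 ^ k → 5 ^ k ≤ L ^ 4
5^k≤L^4 {k} {L} h = ^-cancelʳ-* 5 81 16 k (L ^ 4) (n≤1+n 80) (begin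
  81 ^ k            ≡⟨ trans (^-*-assoc 3 4 k) (cong (3 ^_) (*-comm 4 k)) ⟩
  3 ^ (k * 4)       ≤⟨ raise {k} {k} {L} 4 h ⟩
  L ^ 4 * 16 ^ k    ∎)
  where open ≤-Reasoning

-- 3^12 / 2^16 > 5.
5^k≤L^16 : ∀ {J a k L} → 4 * a ≤ k → J + a ≡ k → 3 ^ J ≤ L * 2 ^ k → 5 ^ k ≤ L ^ 16
5^k≤L^16 {J} {a} {k} {L} 4a≤k refl h = ^-cancelʳ-* 5 (3 ^ 12) (2 ^ 16) k (L ^ 16)
  (≤ᵇ⇒≤ (5 * 2 ^ 16) (3 ^ 12) _) (begin
  (3 ^ 12) ^ k            ≡⟨ ^-*-assoc 3 12 k ⟩
  3 ^ (12 * (J + a))      ≤⟨ ^-monoʳ-≤ 3 12k≤16J ⟩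
  3 ^ (J * 16)            ≤⟨ raise {J} {k} {L} 16 h ⟩
  L ^ 16 * (2 ^ 16) ^ k   ∎)
  where
  open ≤-Reasoning
  3a≤J : 3 * a ≤ J
  3a≤J = +-cancelˡ-≤ a _ _ (≤-trans 4a≤k (≤-reflexive (+-comm J a)))
  -- `J` is at least three quarters of J + a, the value of `k`.
  12k≤16J : 12 * (J + a) ≤ J * 16
  12k≤16J = begin
    12 * (J + a)           ≡⟨ expand J a ⟩
    12 * J + 4 * (3 * a)   ≤⟨ +-monoʳ-≤ (12 * J) (*-monoʳ-≤ 4 3a≤J) ⟩
    12 * J + 4 * J         ≡⟨ collect J ⟩
    J * 16                 ∎
    where
    expand : ∀ J a → 12 * (J + a) ≡ 12 * J + 4 * (3 * a)
    expand = ℕ.solve-∀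
    collect : ∀ J → 12 * J + 4 * J ≡ J * 16
    collect = ℕ.solve-∀

-- For d = 0 the tail is empty, so J = k and the fourth power suffices. Otherwise the exponent is at
-- least 16, which makes up for the quarter of `k` that `J` may lack. L = 0 is separate because
-- powers of `L` grow with the exponent only for positive `L`.
unbalanced-bound : ∀ {d J a k L} → (d ≡ 0 → a ≡ 0) → 4 * a ≤ k → J + a ≡ k →
                   3 ^ J ≤ L * 2 ^ k → 5 ^ k ≤ L ^ (4 ^ suc d)
unbalanced-bound {zero} {J} {a} {k} {L} a≡0 _ eq h =
  5^k≤L^4 {k} {L} (subst (λ j → 3 ^ j ≤ L * 2 ^ k)
    (trans (sym (+-identityʳ J)) (trans (cong (λ z → J + z) (sym (a≡0 refl))) eq)) h)
unbalanced-bound {suc d} {J} {a} {k} {zero}  _ _ _ h =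
  contradiction h (<⇒≱ (m^n>0 3 J))
unbalanced-bound {suc d} {J} {a} {k} {L@(suc _)} _ 4a≤k eq h =
  ≤-trans (5^k≤L^16 {J} {a} {k} {L} 4a≤k eq h) (^-monoʳ-≤ L (^-monoʳ-≤ 4 (s≤s (s≤s (z≤n {d})))))

zero-or-heavy : ∀ {E : (Vec ℕ d → ℤ) → ℤ} → Measure k L E →
                (∀ β → sum β ≢ k → E (mono β) ≡ 0ℤ) →
                IsZero E ⊎ 5 ^ k ≤ L ^ (4 ^ d)
zero-or-heavy {zero} {k} {L} μ vanish with zero-or-moment μ
... | inj₁ E≡0       = inj₁ E≡0
... | inj₂ ([] , ≢0) with k
-- The only moment in dimension 0 has degree 0, so it survives only for k = 0; a nonzero integer
-- then has absolute value at least 1.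
...   | suc _ = contradiction (vanish [] λ ()) ≢0
...   | zero  = inj₂ (begin
  1          ≤⟨ n≢0⇒n>0 (≢0 ∘ ℤ.∣i∣≡0⇒i≡0) ⟩
  _          ≤⟨ Measure.bounded μ 1 (mono []) (λ { [] _ → ≤-refl }) ⟩
  L ^ 1      ∎)
  where open ≤-Reasoning
zero-or-heavy {suc d} {k} {L} {E} μ vanish with zero-or-top μ
... | inj₁ E≡0 = inj₁ E≡0
... | inj₂ (top J α bound ≢0) = inj₂ (large (4 * sum α ≤? k))
  where
  moment≢0 : E (mono (J ∷ α)) ≢ 0ℤ
  moment≢0 = ≢0 ∘ trans (slice-mono bound α)
  J+α≡k : J + sum α ≡ k
  J+α≡k = decidable-stable (J + sum α ≟ k) (moment≢0 ∘ vanish (J ∷ α))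
  -- The slice inherits the hypothesis with `sum α` in place of `k`, since its moment `β` is the
  -- moment `J ∷ β` of `E`.
  vanish′ : ∀ β → sum β ≢ sum α → slice J E (mono β) ≡ 0ℤ
  vanish′ β β≢α = trans (slice-mono bound β)
    (vanish (J ∷ β) λ eq → β≢α (+-cancelˡ-≡ J _ _ (trans eq (sym J+α≡k))))
  empty : ∀ {d} (v : Vec ℕ d) → d ≡ 0 → sum v ≡ 0
  empty [] refl = refl
  large : Dec (4 * sum α ≤ k) → 5 ^ k ≤ L ^ (4 ^ suc d)
  large (yes 4α≤k) = unbalanced-bound {d} {J} {L = L} (empty α) 4α≤k J+α≡k
    (moment-bound μ vanish α bound J+α≡k moment≢0)
  -- The tail has more than a quarter of `k`, so the fourth power gained from 4^d to 4^(d + 1) lifts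
  -- 5^(sum α) to at least 5^k.
  large (no 4α≰k) with zero-or-heavy {E = slice J E} (slice-measure {J = J} J+α≡k μ) vanish′
  ... | inj₁ slice≡0 = contradiction (slice≡0 (mono α)) ≢0
  ... | inj₂ heavy   = begin
    5 ^ k                 ≤⟨ ^-monoʳ-≤ 5 (≰⇒≥ 4α≰k) ⟩
    5 ^ (4 * sum α)       ≡⟨ cong (5 ^_) (*-comm 4 (sum α)) ⟩
    5 ^ (sum α * 4)       ≡⟨ ^-*-assoc 5 (sum α) 4 ⟨
    (5 ^ sum α) ^ 4       ≤⟨ ^-monoˡ-≤ 4 heavy ⟩
    (L ^ (4 ^ d)) ^ 4     ≡⟨ m^4^[1+d] L d ⟨
    L ^ (4 ^ suc d)       ∎
    where open ≤-Reasoning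

-- Finite sums

∑ : (A → ℤ) → List A → ℤ
∑ f []       = 0ℤ
∑ f (x ∷ xs) = f x ℤ.+ ∑ f xs

∑-cong : ∀ {f g : A → ℤ} → f ≗ g → ∑ f ≗ ∑ g
∑-cong f≗g []       = refl
∑-cong f≗g (x ∷ xs) = cong₂ ℤ._+_ (f≗g x) (∑-cong f≗g xs)

∑-zero : ∀ (xs : List A) → ∑ (λ _ → 0ℤ) xs ≡ 0ℤ
∑-zero []       = refl
∑-zero (x ∷ xs) = trans (ℤ.+-identityˡ _) (∑-zero xs)

∑-distrib-+ : ∀ (f g : A → ℤ) xs → ∑ (λ x → f x ℤ.+ g x) xs ≡ ∑ f xs ℤ.+ ∑ g xs
∑-distrib-+ f g []       = refl
∑-distrib-+ f g (x ∷ xs) = trans (cong (ℤ._+_ (f x ℤ.+ g x)) (∑-distrib-+ f g xs))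
  (ring (f x) (g x) (∑ f xs) (∑ g xs))
  where
  ring : ∀ a b c d → a ℤ.+ b ℤ.+ (c ℤ.+ d) ≡ a ℤ.+ c ℤ.+ (b ℤ.+ d)
  ring = ℤ.solve-∀

*-distribˡ-∑ : ∀ a (f : A → ℤ) xs → ∑ (λ x → a ℤ.* f x) xs ≡ a ℤ.* ∑ f xs
*-distribˡ-∑ a f []       = sym (ℤ.*-zeroʳ a)
*-distribˡ-∑ a f (x ∷ xs) = trans (cong (ℤ._+_ (a ℤ.* f x)) (*-distribˡ-∑ a f xs))
  (sym (ℤ.*-distribˡ-+ a (f x) (∑ f xs)))

∑-map : ∀ (f : B → ℤ) (g : A → B) xs → ∑ f (map g xs) ≡ ∑ (f ∘ g) xs
∑-map f g []       = refl
∑-map f g (x ∷ xs) = cong (ℤ._+_ (f (g x))) (∑-map f g xs)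

∑-swap : ∀ (f : A → B → ℤ) xs ys → ∑ (λ x → ∑ (f x) ys) xs ≡ ∑ (λ y → ∑ (λ x → f x y) xs) ys
∑-swap f []       ys = sym (∑-zero ys)
∑-swap f (x ∷ xs) ys = trans (cong (ℤ._+_ (∑ (f x) ys)) (∑-swap f xs ys)) (sym (∑-distrib-+ (f x) _ ys))

∑-allFin-suc : ∀ (f : Fin (suc k) → ℤ) → ∑ f (allFin (suc k)) ≡ f zero ℤ.+ ∑ (f ∘ suc) (allFin k)
∑-allFin-suc f = cong (ℤ._+_ (f zero)) (trans (cong (∑ f) (sym (map-tabulate id suc))) (∑-map f suc (allFin _)))

∑-const : ∀ {x : A} f {xs} → All (x ≡_) xs → ∑ f xs ≡ + length xs ℤ.* f x
∑-const f []                   = refl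
∑-const {x = x} f {x ∷ xs} (refl ∷ eqs) = trans (cong (ℤ._+_ (f x)) (∑-const f eqs)) (ring (f x) (+ length xs))
  where
  ring : ∀ a b → a ℤ.+ b ℤ.* a ≡ (1ℤ ℤ.+ b) ℤ.* a
  ring = ℤ.solve-∀

∣∑∣≤ : ∀ (f : A → ℤ) {xs} b → All (λ x → ∣ f x ∣ ≤ b) xs → ∣ ∑ f xs ∣ ≤ length xs * b
∣∑∣≤ f b []             = z≤n
∣∑∣≤ f b (f≤ ∷ fs≤) = ≤-trans (ℤ.∣i+j∣≤∣i∣+∣j∣ (f _) _) (+-mono-≤ f≤ (∣∑∣≤ f b fs≤))

∑-cong-All : ∀ {f g : A → ℤ} {xs} → All (λ x → f x ≡ g x) xs → ∑ f xs ≡ ∑ g xs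
∑-cong-All []         = refl
∑-cong-All (eq ∷ eqs) = cong₂ ℤ._+_ eq (∑-cong-All eqs)

difference-measure : ∀ {xs ys : List (Vec ℕ d)} → All (λ f → sum f ≤ k) xs → All (λ f → sum f ≤ k) ys →
                     Measure k (length xs + length ys) (λ φ → ∑ φ xs ℤ.- ∑ φ ys)
difference-measure {xs = xs} {ys} xs≤k ys≤k = record
  { additive    = λ φ ψ → trans (cong₂ ℤ._-_ (∑-distrib-+ φ ψ xs) (∑-distrib-+ φ ψ ys))
      (ring₁ (∑ φ xs) (∑ ψ xs) (∑ φ ys) (∑ ψ ys))
  ; homogeneous = λ a φ → trans (cong₂ ℤ._-_ (*-distribˡ-∑ a φ xs) (*-distribˡ-∑ a φ ys))
      (ring₂ a (∑ φ xs) (∑ φ ys))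
  ; local       = λ φ ψ eq → cong₂ ℤ._-_ (∑-cong-All (All.map (eq _) xs≤k)) (∑-cong-All (All.map (eq _) ys≤k))
  ; bounded     = λ b φ ≤b → ≤-trans (ℤ.∣i-j∣≤∣i∣+∣j∣ (∑ φ xs) (∑ φ ys))
      (≤-trans (+-mono-≤ (∣∑∣≤ φ b (All.map (≤b _) xs≤k)) (∣∑∣≤ φ b (All.map (≤b _) ys≤k)))
               (≤-reflexive (sym (*-distribʳ-+ b (length xs) (length ys)))))
  }
  where
  ring₁ : ∀ a b c d → (a ℤ.+ b) ℤ.- (c ℤ.+ d) ≡ (a ℤ.- c) ℤ.+ (b ℤ.- d)
  ring₁ = ℤ.solve-∀
  ring₂ : ∀ a b c → a ℤ.* b ℤ.- a ℤ.* c ≡ a ℤ.* (b ℤ.- c)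
  ring₂ = ℤ.solve-∀

-- Column profiles

-- Symbol 0 is not recorded: its count follows from the other counts and the length of the column.
bump : Fin (suc d) → Vec ℕ d → Vec ℕ d
bump zero    f = f
bump (suc s) f = updateAt f s suc

profile : (Fin k → Fin (suc d)) → Vec ℕ d
profile {zero}  x = replicate _ 0
profile {suc k} x = bump (x zero) (profile (x ∘ suc))

profileOff : Fin k → (Fin k → Fin (suc d)) → Vec ℕ d
profileOff zero    x = profile (x ∘ suc)
profileOff (suc i) x = bump (x zero) (profileOff i (x ∘ suc))

sum-updateAt : ∀ (f : Vec ℕ d) s → sum (updateAt f s suc) ≡ suc (sum f)
sum-updateAt (j ∷ f) zero    = refl
sum-updateAt (j ∷ f) (suc s) = trans (cong (λ z → j + z) (sum-updateAt f s)) (+-suc j (sum f))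

sum-bump : ∀ s (f : Vec ℕ d) → sum (bump s f) ≤ suc (sum f)
sum-bump zero    f = n≤1+n _
sum-bump (suc s) f = ≤-reflexive (sum-updateAt f s)

sum-replicate-0 : ∀ d → sum (replicate d 0) ≡ 0
sum-replicate-0 zero    = refl
sum-replicate-0 (suc d) = sum-replicate-0 d

sum-profile≤ : (x : Fin k → Fin (suc d)) → sum (profile x) ≤ k
sum-profile≤ {zero} {d} x = ≤-reflexive (sum-replicate-0 d)
sum-profile≤ {suc k} x = ≤-trans (sum-bump (x zero) _) (s≤s (sum-profile≤ (x ∘ suc)))

-- The missing entry makes the inequality strict. The smaller range of profiles later pays for the
-- flag bit of a message.
sum-profileOff< : (i : Fin k) (x : Fin k → Fin (suc d)) → sum (profileOff i x) < k
sum-profileOff< zero    x = s≤s (sum-profile≤ (x ∘ suc))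
sum-profileOff< (suc i) x = s≤s (≤-trans (sum-bump (x zero) _) (sum-profileOff< i (x ∘ suc)))

profile-cong : {x y : Fin k → Fin (suc d)} → x ≗ y → profile x ≡ profile y
profile-cong {zero}  x≗y = refl
profile-cong {suc k} x≗y = cong₂ bump (x≗y zero) (profile-cong (x≗y ∘ suc))

profileOff-cong : (i : Fin k) {x y : Fin k → Fin (suc d)} →
                  (∀ j → j ≢ i → x j ≡ y j) → profileOff i x ≡ profileOff i y
profileOff-cong zero    eq = profile-cong (λ j → eq (suc j) λ ())
profileOff-cong (suc i) eq = cong₂ bump (eq zero λ ())
  (profileOff-cong i λ j j≢i → eq (suc j) (j≢i ∘ sucᶠ-injective))

-- Stated for `tabulate g` rather than `allFin`, so that the induction can pass to the tail of the
-- list.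
lookup-profile : ∀ {m} (x : Fin m → Fin (suc d)) (g : Fin k → Fin m) s →
                 length (filter (λ i → x i ≟ᶠ suc s) (tabulate g)) ≡ lookup (profile (x ∘ g)) s
lookup-profile {k = zero}  x g s = sym (lookup-replicate s 0)
lookup-profile {k = suc k} x g s with x (g zero) ≟ᶠ suc s
... | yes eq rewrite eq = trans (cong suc (lookup-profile x (g ∘ suc) s))
  (sym (lookup∘updateAt s (profile (x ∘ g ∘ suc))))
... | no ≢s = trans (lookup-profile x (g ∘ suc) s) (sym (lookup-bump (x (g zero)) ≢s))
  where
  lookup-bump : ∀ t → t ≢ suc s → lookup (bump t (profile (x ∘ g ∘ suc))) s ≡ lookup (profile (x ∘ g ∘ suc)) s
  lookup-bump zero    _  = refl
  lookup-bump (suc t) ≢s = lookup∘updateAt′ s t (≢s ∘ cong suc ∘ sym) (profile (x ∘ g ∘ suc))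

-- Pascal's rule in the coordinate raised by `s`, with `γ` equal to `β` lowered by one there.
-- Nothing changes if `s` is 0 or if `β` is 0 in that coordinate.
binom-pascal : ∀ s (β : Vec ℕ d) →
  (∀ f → binom (bump s f) β ≡ binom f β) ⊎
  ∃ λ γ → sum β ≡ suc (sum γ) × (∀ f → binom (bump s f) β ≡ binom f β + binom f γ)
binom-pascal zero          β           = inj₁ λ _ → refl
binom-pascal (suc zero)    (zero ∷ β)  = inj₁ λ { (j ∷ f) → refl }
binom-pascal (suc zero)    (suc i ∷ β) = inj₂ (i ∷ β , refl , λ { (j ∷ f) → begin
  (suc j C suc i) * binom f β                     ≡⟨ cong (_* binom f β) (nCk+nC[k+1]≡[n+1]C[k+1] j i) ⟨
  (j C i + j C suc i) * binom f β                 ≡⟨ *-distribʳ-+ (binom f β) (j C i) (j C suc i) ⟩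
  (j C i) * binom f β + (j C suc i) * binom f β   ≡⟨ +-comm ((j C i) * binom f β) _ ⟩
  (j C suc i) * binom f β + (j C i) * binom f β   ∎ })
  where open ≡-Reasoning
binom-pascal (suc (suc s)) (i ∷ β) with binom-pascal (suc s) β
... | inj₁ eq = inj₁ λ { (j ∷ f) → cong ((j C i) *_) (eq f) }
... | inj₂ (γ , sum≡ , eq) = inj₂ (i ∷ γ , trans (cong (λ z → i + z) sum≡) (+-suc i (sum γ)) ,
  λ { (j ∷ f) → trans (cong ((j C i) *_) (eq f)) (*-distribˡ-+ (j C i) (binom f β) (binom f γ)) })

-- Either β = 0 and the first factor vanishes, or some coordinate i is positive and 0 C i vanishes.
binom-replicate-0 : ∀ (β : Vec ℕ d) → sum β * binom (replicate d 0) β ≡ 0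
binom-replicate-0 []          = refl
binom-replicate-0 (zero ∷ β)  = trans (cong (sum β *_) (+-identityʳ _)) (binom-replicate-0 β)
binom-replicate-0 (suc i ∷ β) = *-zeroʳ (suc i + sum β)

-- Induction step for prepending an entry `s`: the first summand belongs to the deletion of `s`
-- itself, the others keep it. In the Pascal case 1 + c - |β| = c - |γ|, so both parts get the same
-- coefficient.
∑-mono-bump : ∀ s (β : Vec ℕ d) (g : A → Vec ℕ d) f (c : ℤ) xs →
  (∀ γ → ∑ (mono γ ∘ g) xs ≡ (c ℤ.- + sum γ) ℤ.* mono γ f) →
  mono β f ℤ.+ ∑ (mono β ∘ bump s ∘ g) xs ≡ (1ℤ ℤ.+ c ℤ.- + sum β) ℤ.* mono β (bump s f)
∑-mono-bump s β g f c xs ih with binom-pascal s β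
... | inj₁ eq = begin
  mono β f ℤ.+ ∑ (mono β ∘ bump s ∘ g) xs
    ≡⟨ cong (ℤ._+_ (mono β f)) (trans (∑-cong (λ x → cong +_ (eq (g x))) xs) (ih β)) ⟩
  mono β f ℤ.+ (c ℤ.- + sum β) ℤ.* mono β f            ≡⟨ ring (mono β f) c (+ sum β) ⟩
  (1ℤ ℤ.+ c ℤ.- + sum β) ℤ.* mono β f                  ≡⟨ cong (λ z → (1ℤ ℤ.+ c ℤ.- + sum β) ℤ.* + z) (eq f) ⟨
  (1ℤ ℤ.+ c ℤ.- + sum β) ℤ.* mono β (bump s f)         ∎
  where
  open ≡-Reasoning
  ring : ∀ x c b → x ℤ.+ (c ℤ.- b) ℤ.* x ≡ (1ℤ ℤ.+ c ℤ.- b) ℤ.* x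
  ring = ℤ.solve-∀
... | inj₂ (γ , sum≡ , eq) = begin
  mono β f ℤ.+ ∑ (mono β ∘ bump s ∘ g) xs
    ≡⟨ cong (ℤ._+_ (mono β f)) (trans (∑-cong (pascal ∘ g) xs) (∑-distrib-+ (mono β ∘ g) (mono γ ∘ g) xs)) ⟩
  mono β f ℤ.+ (∑ (mono β ∘ g) xs ℤ.+ ∑ (mono γ ∘ g) xs)
    ≡⟨ cong (ℤ._+_ (mono β f)) (cong₂ ℤ._+_ (ih β) (ih γ)) ⟩
  mono β f ℤ.+ ((c ℤ.- + sum β) ℤ.* mono β f ℤ.+ (c ℤ.- + sum γ) ℤ.* mono γ f)
    ≡⟨ cong (λ z → mono β f ℤ.+ ((c ℤ.- z) ℤ.* mono β f ℤ.+ (c ℤ.- + sum γ) ℤ.* mono γ f)) sum≡′ ⟩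
  mono β f ℤ.+ ((c ℤ.- (1ℤ ℤ.+ + sum γ)) ℤ.* mono β f ℤ.+ (c ℤ.- + sum γ) ℤ.* mono γ f)
    ≡⟨ ring (mono β f) (mono γ f) c (+ sum γ) ⟩
  (1ℤ ℤ.+ c ℤ.- (1ℤ ℤ.+ + sum γ)) ℤ.* (mono β f ℤ.+ mono γ f)
    ≡⟨ cong₂ (λ y z → (1ℤ ℤ.+ c ℤ.- y) ℤ.* z) sum≡′ (pascal f) ⟨
  (1ℤ ℤ.+ c ℤ.- + sum β) ℤ.* mono β (bump s f) ∎
  where
  open ≡-Reasoning
  pascal : ∀ f → mono β (bump s f) ≡ mono β f ℤ.+ mono γ f
  pascal f = trans (cong +_ (eq f)) (ℤ.pos-+ (binom f β) (binom f γ))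
  sum≡′ : + sum β ≡ 1ℤ ℤ.+ + sum γ
  sum≡′ = cong +_ sum≡
  ring : ∀ x y c b → x ℤ.+ ((c ℤ.- (1ℤ ℤ.+ b)) ℤ.* x ℤ.+ (c ℤ.- b) ℤ.* y) ≡
         (1ℤ ℤ.+ c ℤ.- (1ℤ ℤ.+ b)) ℤ.* (x ℤ.+ y)
  ring = ℤ.solve-∀

-- Double counting: `mono β` counts the choices of `β s` occurrences of each symbol, and such a
-- choice survives the deletion of exactly the k - |β| rows outside it.
∑-mono-profileOff : ∀ k (x : Fin k → Fin (suc d)) β →
  ∑ (λ i → mono β (profileOff i x)) (allFin k) ≡ (+ k ℤ.- + sum β) ℤ.* mono β (profile x)
∑-mono-profileOff zero x β = sym (trans (ring (+ sum β) (mono β (replicate _ 0)))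
  (cong ℤ.-_ (trans (sym (ℤ.pos-* (sum β) _)) (cong +_ (binom-replicate-0 β)))))
  where
  ring : ∀ b y → (0ℤ ℤ.- b) ℤ.* y ≡ ℤ.- (b ℤ.* y)
  ring = ℤ.solve-∀
∑-mono-profileOff (suc k) x β = trans (∑-allFin-suc (λ i → mono β (profileOff i x)))
  (∑-mono-bump (x zero) β (λ i → profileOff i (x ∘ suc)) (profile (x ∘ suc)) (+ k) (allFin k)
    (∑-mono-profileOff k (x ∘ suc)))

-- Encoding of the messages

simplex : ∀ d → ℕ → List (Vec ℕ d)
simplex zero    k       = [] ∷ []
simplex (suc d) zero    = map (0 ∷_) (simplex d zero)
simplex (suc d) (suc k) = map (0 ∷_) (simplex d (suc k)) ++ map (bump (suc zero)) (simplex (suc d) k)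

-- Splitting by whether the first coordinate is zero reproduces Pascal's rule.
length-simplex : ∀ d k → length (simplex d k) ≡ (k + d) C d
length-simplex zero    k    = refl
length-simplex (suc d) zero = begin
  length (map (0 ∷_) (simplex d zero))  ≡⟨ length-map (0 ∷_) (simplex d zero) ⟩
  length (simplex d zero)               ≡⟨ length-simplex d zero ⟩
  d C d                                 ≡⟨ trans (nCn≡1 d) (sym (nCn≡1 (suc d))) ⟩
  suc d C suc d                         ∎
  where open ≡-Reasoning
length-simplex (suc d) (suc k) = begin
  length (simplex (suc d) (suc k))
    ≡⟨ length-++ (map (0 ∷_) (simplex d (suc k))) ⟩
  length (map (0 ∷_) (simplex d (suc k))) + length (map (bump (suc zero)) (simplex (suc d) k))
    ≡⟨ cong₂ _+_ (length-map (0 ∷_) (simplex d (suc k))) (length-map (bump (suc zero)) (simplex (suc d) k)) ⟩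
  length (simplex d (suc k)) + length (simplex (suc d) k)
    ≡⟨ cong₂ _+_ (length-simplex d (suc k)) (length-simplex (suc d) k) ⟩
  (suc k + d) C d + (k + suc d) C suc d
    ≡⟨ cong (λ m → m C d + (k + suc d) C suc d) (+-suc k d) ⟨
  (k + suc d) C d + (k + suc d) C suc d
    ≡⟨ nCk+nC[k+1]≡[n+1]C[k+1] (k + suc d) d ⟩
  (suc k + suc d) C suc d ∎
  where open ≡-Reasoning

∈-simplex : ∀ (f : Vec ℕ d) k → sum f ≤ k → f ∈ simplex d k
∈-simplex []          k       _         = here refl
∈-simplex (zero ∷ f)  zero    f≤k       = ∈-map⁺ (0 ∷_) (∈-simplex f zero f≤k)
∈-simplex (zero ∷ f)  (suc k) f≤k       = ∈-++⁺ˡ (∈-map⁺ (0 ∷_) (∈-simplex f (suc k) f≤k))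
∈-simplex (suc j ∷ f) (suc k) (s≤s f≤k) = ∈-++⁺ʳ _ (∈-map⁺ (bump (suc zero)) (∈-simplex (j ∷ f) k f≤k))

simplex-unique : ∀ d k → Unique (simplex d k)
simplex-unique zero    k       = [] ∷ []
simplex-unique (suc d) zero    = Unique.map⁺ (λ { refl → refl }) (simplex-unique d zero)
simplex-unique (suc d) (suc k) = Unique.++⁺
  (Unique.map⁺ (λ { refl → refl }) (simplex-unique d (suc k)))
  (Unique.map⁺ (λ { {_ ∷ _} {_ ∷ _} refl → refl }) (simplex-unique (suc d) k))
  disjoint
  where
  disjoint : ∀ {v} → ¬ (v ∈ map (0 ∷_) (simplex d (suc k)) × v ∈ map (bump (suc zero)) (simplex (suc d) k))
  disjoint (v∈₀ , v∈₁) with ∈-map⁻ (0 ∷_) v∈₀ | ∈-map⁻ (bump (suc zero)) v∈₁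
  ... | _ , _ , refl | _ ∷ _ , _ , ()

bits : ℕ → ℕ → List Bool
bits zero    m = []
bits (suc l) m with m <? 2 ^ l
... | yes _ = false ∷ bits l m
... | no  _ = true ∷ bits l (m ∸ 2 ^ l)

length-bits : ∀ l m → length (bits l m) ≡ l
length-bits zero    m = refl
length-bits (suc l) m with m <? 2 ^ l
... | yes _ = cong suc (length-bits l m)
... | no  _ = cong suc (length-bits l (m ∸ 2 ^ l))

bits-injective : ∀ l {m n} → m < 2 ^ l → n < 2 ^ l → bits l m ≡ bits l n → m ≡ n
bits-injective zero    (s≤s z≤n) (s≤s z≤n) _ = refl
bits-injective (suc l) {m} {n} m< n< eq with m <? 2 ^ l | n <? 2 ^ l
... | yes m<′ | yes n<′ = bits-injective l m<′ n<′ (∷-injectiveʳ eq)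
... | no m≮   | no n≮   = ∸-cancelʳ-≡ (≮⇒≥ m≮) (≮⇒≥ n≮)
  (bits-injective l (below m<) (below n<) (∷-injectiveʳ eq))
  where
  below : ∀ {x} → x < 2 ^ suc l → x ∸ 2 ^ l < 2 ^ l
  below x< = m<n+o⇒m∸n<o _ (2 ^ l) {{m^n≢0 2 l}}
    (<-≤-trans x< (≤-reflexive (cong (λ z → 2 ^ l + z) (+-identityʳ (2 ^ l)))))

-- Strong induction through ⌈n/2⌉, whose rounded logarithm is smaller by one.
n≤2^⌈log₂n⌉ : ∀ n → n ≤ 2 ^ ⌈log₂ n ⌉
n≤2^⌈log₂n⌉ = <-rec _ step
  where
  step : ∀ n → (∀ {m} → m < n → m ≤ 2 ^ ⌈log₂ m ⌉) → n ≤ 2 ^ ⌈log₂ n ⌉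
  step 0             _   = z≤n
  step 1             _   = m^n>0 2 ⌈log₂ 1 ⌉
  step n@(suc (suc m)) rec = begin
    n                                ≡⟨ ⌊n/2⌋+⌈n/2⌉≡n n ⟨
    ⌊ n /2⌋ + ⌈ n /2⌉                ≤⟨ +-monoˡ-≤ ⌈ n /2⌉ (⌊n/2⌋≤⌈n/2⌉ n) ⟩
    ⌈ n /2⌉ + ⌈ n /2⌉                ≤⟨ +-mono-≤ half half ⟩
    2 ^ (l ∸ 1) + 2 ^ (l ∸ 1)        ≡⟨ cong (λ z → 2 ^ (l ∸ 1) + z) (+-identityʳ (2 ^ (l ∸ 1))) ⟨
    2 ^ suc (l ∸ 1)                  ≡⟨ cong (2 ^_) (m+[n∸m]≡n 1≤l) ⟩
    2 ^ l                            ∎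
    where
    open ≤-Reasoning
    l : ℕ
    l = ⌈log₂ n ⌉
    1≤l : 1 ≤ l
    1≤l = ⌈log₂⌉-mono-≤ {2} {n} (s≤s (s≤s z≤n))
    half : ⌈ n /2⌉ ≤ 2 ^ (l ∸ 1)
    half = subst (λ e → ⌈ n /2⌉ ≤ 2 ^ e) (⌈log₂⌈n/2⌉⌉≡⌈log₂n⌉∸1 n) (rec (⌈n/2⌉<n m))

++-injective : ∀ {xs ys zs ws : List A} → length xs ≡ length ys →
               xs ++ zs ≡ ys ++ ws → xs ≡ ys × zs ≡ ws
++-injective {xs = []}     {[]}     _   eq = refl , eq
++-injective {xs = x ∷ xs} {y ∷ ys} len eq
  with ++-injective {xs = xs} {ys} (suc-injective len) (∷-injectiveʳ eq)
... | eq₁ , eq₂ = cong₂ _∷_ (∷-injectiveˡ eq) eq₁ , eq₂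

-- Corresponding blocks have equal lengths, so the concatenation can be cut apart without
-- separators.
concatMap-injective : ∀ {f g : A → List B} → (∀ x → length (f x) ≡ length (g x)) →
                      ∀ {xs} → concatMap f xs ≡ concatMap g xs → ∀ {x} → x ∈ xs → f x ≡ g x
concatMap-injective len eq (here refl) = proj₁ (++-injective (len _) eq)
concatMap-injective len eq (there x∈)  = concatMap-injective len (proj₂ (++-injective (len _) eq)) x∈

length-concatMap : ∀ {f : A → List B} {l} → (∀ x → length (f x) ≡ l) →
                   ∀ xs → length (concatMap f xs) ≡ length xs * l
length-concatMap len []       = refl
length-concatMap {f = f} len (x ∷ xs) = trans (length-++ (f x)) (cong₂ _+_ (len x) (length-concatMap len xs))

indicator : {P : Set} → Dec P → ℤ
indicator p? = if does p? then 1ℤ else 0ℤ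

length-filter : ∀ {P : A → Set} (P? : Decidable P) xs → + length (filter P? xs) ≡ ∑ (indicator ∘ P?) xs
length-filter P? []       = refl
length-filter P? (x ∷ xs) with does (P? x)
... | true  = cong (ℤ._+_ 1ℤ) (length-filter P? xs)
... | false = trans (length-filter P? xs) (sym (ℤ.+-identityˡ _))

module Encoding {A : Set} (_≟ᴬ_ : DecidableEquality A) where

  count : A → List A → ℕ
  count e xs = length (filter (e ≟ᴬ_) xs)

  -- A count can equal the number of columns, which may not fit into l bits;
  -- then all points coincide and a one-hot vector is sent instead.
  encode : List A → ℕ → List A → List Bool
  encode T l []         = []
  encode T l xs@(x ∷ xs′) with All.all? (x ≟ᴬ_) xs′
  ... | yes _ = true ∷ concatMap (λ e → does (e ≟ᴬ x) ∷ []) T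
  ... | no  _ = false ∷ concatMap (λ e → bits l (count e xs)) T

  -- One flag bit, then per entry of `T` either `l` bits or a single bit, which 1 ≤ l covers.
  length-encode : ∀ T {l} xs → 1 ≤ l → length (encode T l xs) ≤ suc (length T * l)
  length-encode T []       1≤l = z≤n
  length-encode T {l} (x ∷ xs) 1≤l with All.all? (x ≟ᴬ_) xs
  ... | yes _ = s≤s (≤-trans (≤-reflexive (length-concatMap (λ _ → refl) T)) (*-monoʳ-≤ (length T) 1≤l))
  ... | no  _ = s≤s (≤-reflexive (length-concatMap (λ e → length-bits l (count e (x ∷ xs))) T))

  ∑-pick-∉ : ∀ (φ : A → ℤ) {x T} → All (_≢ x) T → ∑ (λ e → φ e ℤ.* indicator (e ≟ᴬ x)) T ≡ 0ℤ
  ∑-pick-∉ φ []                      = refl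
  ∑-pick-∉ φ {x} {e ∷ T} (e≢x ∷ ≢xs) rewrite dec-false (e ≟ᴬ x) e≢x
    | ∑-pick-∉ φ ≢xs | ℤ.*-zeroʳ (φ e) = refl

  ∑-pick : ∀ (φ : A → ℤ) {x T} → Unique T → x ∈ T → ∑ (λ e → φ e ℤ.* indicator (e ≟ᴬ x)) T ≡ φ x
  ∑-pick φ {x} (x≢ ∷ _) (here refl)
    rewrite dec-true (x ≟ᴬ x) refl | ∑-pick-∉ φ (All.map (_∘ sym) x≢) =
    trans (ℤ.+-identityʳ _) (ℤ.*-identityʳ (φ x))
  ∑-pick φ {x} {e ∷ T} (e≢ ∷ u) (there x∈)
    rewrite dec-false (e ≟ᴬ x) (All.lookup e≢ x∈) | ∑-pick φ u x∈ | ℤ.*-zeroʳ (φ e) = ℤ.+-identityˡ (φ x)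

  -- Grouping equal terms shows that the counts over `T` determine every sum.
  ∑-count : ∀ (φ : A → ℤ) {T} → Unique T → ∀ {xs} → All (_∈ T) xs →
            ∑ φ xs ≡ ∑ (λ e → φ e ℤ.* + count e xs) T
  ∑-count φ {T} u {xs} xs⊆T = begin
    ∑ φ xs                                                      ≡⟨ ∑-cong-All (All.map (sym ∘ ∑-pick φ u) xs⊆T) ⟩
    ∑ (λ x → ∑ (λ e → φ e ℤ.* indicator (e ≟ᴬ x)) T) xs         ≡⟨ ∑-swap (λ x e → φ e ℤ.* indicator (e ≟ᴬ x)) xs T ⟩
    ∑ (λ e → ∑ (λ x → φ e ℤ.* indicator (e ≟ᴬ x)) xs) T
      ≡⟨ ∑-cong (λ e → trans (*-distribˡ-∑ (φ e) _ xs) (cong (φ e ℤ.*_) (sym (length-filter (e ≟ᴬ_) xs)))) T ⟩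
    ∑ (λ e → φ e ℤ.* + count e xs) T                            ∎
    where open ≡-Reasoning

  -- Without a constant list no count reaches the length, so every count fits into `l` bits.
  count< : ∀ e {x xs} → ¬ All (x ≡_) xs → count e (x ∷ xs) < length (x ∷ xs)
  count< e {x} {xs} ¬all = filter-notAll (e ≟ᴬ_) (x ∷ xs) differs
    where
    differs : Any (λ y → ¬ e ≡ y) (x ∷ xs)
    differs with e ≟ᴬ x
    ... | yes refl = there (¬All⇒Any¬ (x ≟ᴬ_) xs ¬all)
    ... | no e≢x   = here e≢x

  -- Equality of multisets is expressed by equality of all sums. The flag bit separates the two
  -- modes: a constant list is fixed by its value and length, any other by its counts.
  encode-injective : ∀ {T} l {xs ys} → Unique T → All (_∈ T) xs → All (_∈ T) ys →
                     length xs ≡ length ys → length xs ≤ 2 ^ l →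
                     encode T l xs ≡ encode T l ys → ∀ φ → ∑ φ xs ≡ ∑ φ ys
  encode-injective l {[]}     {[]}     u ps qs len ≤2^l eq φ = refl
  encode-injective {T} l {x ∷ xs} {y ∷ ys} u ps@(x∈T ∷ _) qs len ≤2^l eq φ
    with All.all? (x ≟ᴬ_) xs | All.all? (y ≟ᴬ_) ys
  ... | yes xs≡ | yes ys≡ = begin
    ∑ φ (x ∷ xs)                  ≡⟨ ∑-const φ (refl ∷ xs≡) ⟩
    + length (x ∷ xs) ℤ.* φ x     ≡⟨ cong₂ (λ m z → + m ℤ.* φ z) len x≡y ⟩
    + length (y ∷ ys) ℤ.* φ y     ≡⟨ ∑-const φ (refl ∷ ys≡) ⟨
    ∑ φ (y ∷ ys)                  ∎
    where
    open ≡-Reasoning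
    -- Compare the two one-hot vectors at the position of `x`.
    does≡ : does (x ≟ᴬ x) ≡ does (x ≟ᴬ y)
    does≡ = ∷-injectiveˡ (concatMap-injective (λ _ → refl) {T} (∷-injectiveʳ eq) x∈T)
    x≡y : x ≡ y
    x≡y with x ≟ᴬ y | trans (sym (dec-true (x ≟ᴬ x) refl)) does≡
    ... | yes x≡y | _  = x≡y
    ... | no _    | ()
  ... | no ¬xs≡ | no ¬ys≡ = begin
    ∑ φ (x ∷ xs)                                ≡⟨ ∑-count φ u ps ⟩
    ∑ (λ e → φ e ℤ.* + count e (x ∷ xs)) T
      ≡⟨ ∑-cong-All (All.tabulate λ {e} e∈T → cong (λ m → φ e ℤ.* + m) (counts≡ e∈T)) ⟩
    ∑ (λ e → φ e ℤ.* + count e (y ∷ ys)) T      ≡⟨ ∑-count φ u qs ⟨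
    ∑ φ (y ∷ ys)                                ∎
    where
    open ≡-Reasoning
    counts≡ : ∀ {e} → e ∈ T → count e (x ∷ xs) ≡ count e (y ∷ ys)
    counts≡ {e} e∈T = bits-injective l
      (<-≤-trans (count< e ¬xs≡) ≤2^l)
      (<-≤-trans (count< e ¬ys≡) (≤-trans (≤-reflexive (sym len)) ≤2^l))
      (concatMap-injective
        (λ e → trans (length-bits l (count e (x ∷ xs))) (sym (length-bits l (count e (y ∷ ys)))))
        (∷-injectiveʳ eq) e∈T)
  ... | yes _ | no _ = contradiction (∷-injectiveˡ eq) λ ()
  ... | no _ | yes _ = contradiction (∷-injectiveˡ eq) λ ()

-- The protocol

column : Matrix k n d → Fin n → Fin k → Fin (suc d)
column M c i = M i c

profiles : Matrix k n d → List (Vec ℕ d)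
profiles {n = n} M = map (profile ∘ column M) (allFin n)

views : Fin k → Matrix k n d → List (Vec ℕ d)
views {n = n} i M = map (profileOff i ∘ column M) (allFin n)

length-allFin : ∀ n → length (allFin n) ≡ n
length-allFin n = length-tabulate id

-- This makes each y a sum over the profiles, so agreement of all such sums suffices.
yCount-∑ : ∀ (M : Matrix k n d) e → + yCount M e ≡ ∑ (λ f → indicator (all? λ s → lookup f s ≟ e s)) (profiles M)
yCount-∑ {n = n} M e = begin
  + yCount M e                                                ≡⟨ length-filter _ (allFin n) ⟩
  ∑ (λ c → indicator (all? λ s → occ M c (suc s) ≟ e s)) (allFin n)
    ≡⟨ ∑-cong (λ c → cong (if_then 1ℤ else 0ℤ) (does-⇔ (occ⇔ c) (all? λ s → occ M c (suc s) ≟ e s) (all? λ s → _ ≟ e s))) (allFin n) ⟩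
  ∑ (λ c → indicator (all? λ s → lookup (profile (column M c)) s ≟ e s)) (allFin n)
    ≡⟨ ∑-map _ (profile ∘ column M) (allFin n) ⟨
  ∑ (λ f → indicator (all? λ s → lookup f s ≟ e s)) (profiles M) ∎
  where
  open ≡-Reasoning
  occ≡ : ∀ c s → occ M c (suc s) ≡ lookup (profile (column M c)) s
  occ≡ c s = lookup-profile (column M c) id s
  occ⇔ : ∀ c → (∀ s → occ M c (suc s) ≡ e s) ⇔ (∀ s → lookup (profile (column M c)) s ≡ e s)
  occ⇔ c = mk⇔ (λ eq s → trans (sym (occ≡ c s)) (eq s)) (λ eq s → trans (occ≡ c s) (eq s))

-- The views thus fix every moment of the profiles except those of degree `k`, where the factor is
-- zero.
∑-views : ∀ (M : Matrix k n d) β →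
          ∑ (λ i → ∑ (mono β) (views i M)) (allFin k) ≡ (+ k ℤ.- + sum β) ℤ.* ∑ (mono β) (profiles M)
∑-views {k} {n} M β = begin
  ∑ (λ i → ∑ (mono β) (views i M)) (allFin k)
    ≡⟨ ∑-cong (λ i → ∑-map (mono β) (profileOff i ∘ column M) (allFin n)) (allFin k) ⟩
  ∑ (λ i → ∑ (λ c → mono β (profileOff i (column M c))) (allFin n)) (allFin k)
    ≡⟨ ∑-swap _ (allFin k) (allFin n) ⟩
  ∑ (λ c → ∑ (λ i → mono β (profileOff i (column M c))) (allFin k)) (allFin n)
    ≡⟨ ∑-cong (λ c → ∑-mono-profileOff k (column M c) β) (allFin n) ⟩
  ∑ (λ c → (+ k ℤ.- + sum β) ℤ.* mono β (profile (column M c))) (allFin n)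
    ≡⟨ *-distribˡ-∑ (+ k ℤ.- + sum β) (λ c → mono β (profile (column M c))) (allFin n) ⟩
  (+ k ℤ.- + sum β) ℤ.* ∑ (λ c → mono β (profile (column M c))) (allFin n)
    ≡⟨ cong ((+ k ℤ.- + sum β) ℤ.*_) (∑-map (mono β) (profile ∘ column M) (allFin n)) ⟨
  (+ k ℤ.- + sum β) ℤ.* ∑ (mono β) (profiles M) ∎
  where open ≡-Reasoning

profiles≤k : ∀ (M : Matrix k n d) → All (λ f → sum f ≤ k) (profiles M)
profiles≤k {n = n} M = map⁺ (All.universal (λ c → sum-profile≤ (column M c)) (allFin n))

views-determine-profiles : ∀ {M M′ : Matrix k n d} → 2 ≤ n → 1 ≤ k → n ^ (4 ^ d) ≤ 2 ^ k →
  (∀ i φ → ∑ φ (views i M) ≡ ∑ φ (views i M′)) → ∀ φ → ∑ φ (profiles M) ≡ ∑ φ (profiles M′)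
views-determine-profiles {k} {n} {d} {M} {M′} 2≤n 1≤k n^≤2^k views≡
  with zero-or-heavy (difference-measure (profiles≤k M) (profiles≤k M′)) vanish
  where
  vanish : ∀ β → sum β ≢ k → ∑ (mono β) (profiles M) ℤ.- ∑ (mono β) (profiles M′) ≡ 0ℤ
  vanish β β≢k with ℤ.i*j≡0⇒i≡0∨j≡0 (+ k ℤ.- + sum β) (begin
    c ℤ.* (∑ (mono β) (profiles M) ℤ.- ∑ (mono β) (profiles M′))
      ≡⟨ ring c (∑ (mono β) (profiles M)) (∑ (mono β) (profiles M′)) ⟩
    c ℤ.* ∑ (mono β) (profiles M) ℤ.- c ℤ.* ∑ (mono β) (profiles M′)
      ≡⟨ cong₂ ℤ._-_ (∑-views M β) (∑-views M′ β) ⟨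
    ∑ (λ i → ∑ (mono β) (views i M)) (allFin k) ℤ.- ∑ (λ i → ∑ (mono β) (views i M′)) (allFin k)
      ≡⟨ ℤ.i≡j⇒i-j≡0 (∑-cong (λ i → views≡ i (mono β)) (allFin k)) ⟩
    0ℤ ∎)
    where
    open ≡-Reasoning
    c : ℤ
    c = + k ℤ.- + sum β
    ring : ∀ c x y → c ℤ.* (x ℤ.- y) ≡ c ℤ.* x ℤ.- c ℤ.* y
    ring = ℤ.solve-∀
  ... | inj₁ c≡0 = contradiction (sym (ℤ.+-injective (ℤ.i-j≡0⇒i≡j (+ k) (+ sum β) c≡0))) β≢k
  ... | inj₂ eq  = eq
... | inj₁ Δ≡0   = λ φ → ℤ.i-j≡0⇒i≡j _ _ (Δ≡0 φ)
... | inj₂ heavy = contradiction heavy (<⇒≱ (begin-strict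
  (length (profiles M) + length (profiles M′)) ^ (4 ^ d)
    ≡⟨ cong₂ (λ a b → (a + b) ^ (4 ^ d)) (length-profiles M) (length-profiles M′) ⟩
  (n + n) ^ (4 ^ d)            ≤⟨ ^-monoˡ-≤ (4 ^ d) n+n≤n*n ⟩
  (n * n) ^ (4 ^ d)            ≡⟨ ^-distribʳ-* (4 ^ d) n n ⟩
  n ^ (4 ^ d) * n ^ (4 ^ d)    ≤⟨ *-mono-≤ n^≤2^k n^≤2^k ⟩
  2 ^ k * 2 ^ k                ≡⟨ ^-distribʳ-* k 2 2 ⟨
  -- Strictness comes from k ≥ 1.
  4 ^ k                        <⟨ ^-monoˡ-< k {{>-nonZero 1≤k}} (n<1+n 4) ⟩
  5 ^ k                        ∎))
  where
  open ≤-Reasoning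
  length-profiles : ∀ (M : Matrix k n d) → length (profiles M) ≡ n
  length-profiles M = trans (length-map _ (allFin n)) (length-allFin n)
  n+n≤n*n : n + n ≤ n * n
  n+n≤n*n = ≤-trans (≤-reflexive (cong (λ z → n + z) (sym (+-identityʳ n)))) (*-monoˡ-≤ n 2≤n)

-- Exhaustive search by the referee

matrixOf : Fin ((suc d ^ n) ^ k) → Matrix k n d
matrixOf a i = finToFun (finToFun a i)

-- Matrices are functions, so the numbered matrix agrees with `M` entrywise; `msg-cong` carries this
-- over to the messages.
matrixOf-surjective : ∀ (M : Matrix k n d) → ∃ λ a → ∀ i c → matrixOf {d} {n} {k} a i c ≡ M i c
matrixOf-surjective M = funToFin (λ i → funToFin (M i)) , λ i c →
  trans (cong (λ b → finToFun b c) (finToFun-funToFin (λ i → funToFin (M i)) i)) (finToFun-funToFin (M i) c)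

module Search (msg : Fin k → Matrix k n d → List Bool)
  (msg-cong : ∀ i {M M′ : Matrix k n d} → (∀ j c → M j c ≡ M′ j c) → msg i M ≡ msg i M′)
  (out : Matrix k n d → (Fin d → ℕ) → ℕ)
  (msgs-determine-out : ∀ {M M′} → (∀ i → msg i M ≡ msg i M′) → ∀ e → out M e ≡ out M′ e)
  where

  explains? : ∀ (r : Fin k → List Bool) (a : Fin ((suc d ^ n) ^ k)) → Dec (∀ i → msg i (matrixOf a) ≡ r i)
  explains? r a = all? λ i → List.≡-dec Bool._≟_ (msg i (matrixOf a)) (r i)

  referee : (Fin k → List Bool) → (Fin d → ℕ) → ℕ
  referee r e with any? (explains? r)
  ... | yes (a , _) = out (matrixOf a) e
  -- A default for inputs that no matrix produces.
  ... | no _        = 0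

  referee-correct : ∀ M e → referee (λ i → msg i M) e ≡ out M e
  referee-correct M e with any? (explains? λ i → msg i M)
  ... | yes (a , eq) = msgs-determine-out eq e
  ... | no none      = contradiction (let a , eq = matrixOf-surjective M in a , λ i → msg-cong i eq) none

-- Cost of the messages

sum-map≤ : ∀ (f : A → ℕ) {b} → (∀ x → f x ≤ b) → ∀ xs → ListAction.sum (map f xs) ≤ length xs * b
sum-map≤ f ≤b []       = z≤n
sum-map≤ f ≤b (x ∷ xs) = +-mono-≤ (≤b x) (sum-map≤ f ≤b xs)

nCk>0 : ∀ {n k} → k ≤ n → 1 ≤ n C k
nCk>0 {n}     {zero}  _         = ≤-refl
nCk>0 {suc n} {suc k} (s≤s k≤n) = begin
  1                  ≤⟨ nCk>0 k≤n ⟩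
  n C k              ≤⟨ m≤m+n (n C k) (n C suc k) ⟩
  n C k + n C suc k  ≡⟨ nCk+nC[k+1]≡[n+1]C[k+1] n k ⟩
  suc n C suc k      ∎
  where open ≤-Reasoning

-- Pascal's rule splits off a positive binomial coefficient, and its product with l ≥ 1 absorbs the
-- flag bit.
simplex-cost : ∀ k d {l} → 1 ≤ l → suc (length (simplex (suc d) k) * l) ≤ ((suc k + suc d) C suc d) * l
simplex-cost k d {l} 1≤l = begin
  suc (length (simplex (suc d) k) * l)               ≡⟨ cong (λ m → suc (m * l)) (length-simplex (suc d) k) ⟩
  1 + ((k + suc d) C suc d) * l                      ≤⟨ +-monoˡ-≤ _ (*-mono-≤ (nCk>0 d≤) 1≤l) ⟩
  ((k + suc d) C d) * l + ((k + suc d) C suc d) * l  ≡⟨ *-distribʳ-+ l ((k + suc d) C d) ((k + suc d) C suc d) ⟨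
  ((k + suc d) C d + (k + suc d) C suc d) * l        ≡⟨ cong (_* l) (nCk+nC[k+1]≡[n+1]C[k+1] (k + suc d) d) ⟩
  ((suc k + suc d) C suc d) * l                      ∎
  where
  open ≤-Reasoning
  d≤ : d ≤ k + suc d
  d≤ = ≤-trans (n≤1+n d) (m≤n+m (suc d) k)

module Protocol (n d k : ℕ) (2≤n : 2 ≤ n) (n^≤2^k : n ^ (4 ^ suc d) ≤ 2 ^ suc k) where
  open Encoding {Vec ℕ (suc d)} (≡-dec _≟_)

  l : ℕ
  l = ⌈log₂ n ⌉

  1≤l : 1 ≤ l
  1≤l = ⌈log₂⌉-mono-≤ {2} 2≤n

  T : List (Vec ℕ (suc d))
  -- There are k + 1 players, and a view omits one entry of each column.
  T = simplex (suc d) k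

  msg : Fin (suc k) → Matrix (suc k) n (suc d) → List Bool
  msg i M = encode T l (views i M)

  msg-view : ∀ i {M M′ : Matrix (suc k) n (suc d)} → (∀ j c → j ≢ i → M j c ≡ M′ j c) →
             msg i M ≡ msg i M′
  msg-view i eq = cong (encode T l) (map-cong (λ c → profileOff-cong i λ j j≢i → eq j c j≢i) (allFin n))

  views⊆T : ∀ i (M : Matrix (suc k) n (suc d)) → All (_∈ T) (views i M)
  views⊆T i M = map⁺ (All.universal
    (λ c → ∈-simplex _ k (≤-pred (sum-profileOff< i (column M c)))) (allFin n))

  length-views : ∀ i (M : Matrix (suc k) n (suc d)) → length (views i M) ≡ n
  length-views i M = trans (length-map _ (allFin n)) (length-allFin n)

  msgs-determine-yCount : ∀ {M M′} → (∀ i → msg i M ≡ msg i M′) → ∀ e → yCount M e ≡ yCount M′ e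
  msgs-determine-yCount {M} {M′} eq e = ℤ.+-injective (begin
    + yCount M e           ≡⟨ yCount-∑ M e ⟩
    ∑ _ (profiles M)       ≡⟨ views-determine-profiles {M = M} {M′} 2≤n (s≤s z≤n) n^≤2^k views≡ _ ⟩
    ∑ _ (profiles M′)      ≡⟨ yCount-∑ M′ e ⟨
    + yCount M′ e          ∎)
    where
    open ≡-Reasoning
    views≡ : ∀ i φ → ∑ φ (views i M) ≡ ∑ φ (views i M′)
    views≡ i = encode-injective l (simplex-unique (suc d) k) (views⊆T i M) (views⊆T i M′)
      (trans (length-views i M) (sym (length-views i M′)))
      (≤-trans (≤-reflexive (length-views i M)) (n≤2^⌈log₂n⌉ n)) (eq i)

  cost : ∀ M → ListAction.sum (map (λ i → length (msg i M)) (allFin (suc k))) ≤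
               suc k * ((suc k + suc d) C suc d) * l
  cost M = begin
    ListAction.sum (map (λ i → length (msg i M)) (allFin (suc k)))
      ≤⟨ sum-map≤ _ (λ i → ≤-trans (length-encode T (views i M) 1≤l) (simplex-cost k d 1≤l)) (allFin (suc k)) ⟩
    length (allFin (suc k)) * (((suc k + suc d) C suc d) * l)
      ≡⟨ cong (_* (((suc k + suc d) C suc d) * l)) (length-allFin (suc k)) ⟩
    suc k * (((suc k + suc d) C suc d) * l)
      ≡⟨ *-assoc (suc k) ((suc k + suc d) C suc d) l ⟨
    suc k * ((suc k + suc d) C suc d) * l ∎
    where open ≤-Reasoning

  open Search msg (λ i eq → msg-view i λ j c _ → eq j c) yCount msgs-determine-yCount

  protocol : YProtocol (suc k) n (suc d) (suc k * ((suc k + suc d) C suc d) * l)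
  protocol = record
    { msg      = msg
    ; msg-view = λ i M M′ agree → msg-view i λ j c j≢i → cong (λ row → row c) (agree j j≢i)
    ; referee  = referee
    ; correct  = λ M e _ → referee-correct M e
    ; cost-ok  = cost
    }

theorem9 : (n d k : ℕ) → 2 ≤ n → 1 ≤ d → n ^ (4 ^ d) ≤ 2 ^ k →
    YProtocol k n d (k * ((k + d) C d) * ⌈log₂ n ⌉)
-- No players is impossible: n^(4^d) ≥ n ≥ 2 exceeds 2^0.
theorem9 n (suc d) zero    2≤n _ n^≤1 = contradiction n^≤1 (<⇒≱ (≤-trans 2≤n
  (≤-trans (≤-reflexive (sym (^-identityʳ n))) (^-monoʳ-≤ n {{>-nonZero (<⇒≤ 2≤n)}} (m^n>0 4 (suc d))))))
theorem9 n (suc d) (suc k) 2≤n _ n^≤2^k = Protocol.protocol n d k 2≤n n^≤2^k
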